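{- Let $N\ge 16$ be an integer, and write $N=3k+i$ with $k\in\mathbb{N}$ and $i\in\{0,1,2\}$. Let $P^N_*$ denote the maximal number of finite paths $|FP(E)|$ over all connected acyclic directed graphs $E$ with exactly $N$ edges. Then $$P^N_*=\begin{cases}\frac14\left(121\cdot 3^{k-2}-2k+7\right) & \text{if } i=0,\\[2pt] \frac14\left(529\cdot 3^{k-3}-2k+25\right) & \text{if } i=1,\\[2pt] \frac14\left(253\cdot 3^{k-2}-2k+15\right) & \text{if } i=2.\end{cases}$$
   Context: A directed graph $E=(E^0,E^1,s_E,t_E)$ consists of a set of vertices $E^0$, a set of edges $E^1$, and source and target maps $s_E,t_E\colon E^1\to E^0$ (multiple edges are allowed). A finite path of length $n\ge1$ is a tuple $(e_1,\dots,e_n)$ of edges with $t_E(e_i)=s_E(e_{i+1})$ for $1\le i<n$; vertices are paths of length $0$. $FP(E)$ is the set of all finite paths in $E$ (including those of length $0$). $E$ is acyclic if it has no path of positive length whose beginning and end coincide. $E$ is connected if any two vertices are joined by a finite undirected path. -}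

module Defs where

open import Data.Fin using (Fin; zero; suc)
open import Data.Integer as ℤ using (+_)
open import Data.List.NonEmpty using (List⁺; head; last; toList)
open import Data.List.Relation.Unary.Linked using (Linked)
open import Data.Nat as ℕ using (ℕ; _∸_; _^_; _≤_)
open import Data.Product using (Σ; ∃; ∃-syntax; _×_)
open import Data.Rational as ℚ using (ℚ)
open import Data.Sum using (_⊎_)
open import Function.Bundles using (_↔_)
open import Relation.Binary.Construct.Closure.Equivalence using (EqClosure)
open import Relation.Binary.PropositionalEquality using (_≡_; _≢_)

record DirectedGraph : Set₁ where
  field
    E⁰     : Set
    E¹     : Set
    source : E¹ → E⁰
    target : E¹ → E⁰

  Consecutive : E¹ → E¹ → Set
  Consecutive e f = target e ≡ source f

  PositivePath : Set
  PositivePath = Σ (List⁺ E¹) λ es → Linked Consecutive (toList es)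

  -- The left summand consists of the paths of length 0.
  FP : Set
  FP = E⁰ ⊎ PositivePath

  Acyclic : Set
  Acyclic = ∀ (es : List⁺ E¹) → Linked Consecutive (toList es) →
            source (head es) ≢ target (last es)

  _⟶_ : E⁰ → E⁰ → Set
  u ⟶ v = ∃[ e ] (source e ≡ u × target e ≡ v)

  -- EqClosure is the type of finite (possibly empty) walks whose steps may be
  -- taken in either direction.
  Connected : Set
  Connected = ∀ u v → EqClosure _⟶_ u v

open DirectedGraph

HasCardinality : Set → ℕ → Set
HasCardinality A n = A ↔ Fin n

record IsConnectedAcyclicWithEdges (N : ℕ) (E : DirectedGraph) : Set where
  field
    edges     : HasCardinality (E¹ E) N
    connected : Connected E
    acyclic   : Acyclic E

-- The value P is attained, and every admissible graph has finitely many finite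
-- paths, at most P of them.  The vertex set is not assumed finite or discrete.
record IsMaximalNumberOfPaths (N P : ℕ) : Set₁ where
  field
    attained   : ∃[ E ] (IsConnectedAcyclicWithEdges N E × HasCardinality (FP E) P)
    upperBound : ∀ E → IsConnectedAcyclicWithEdges N E →
                 ∃[ m ] (HasCardinality (FP E) m × m ≤ P)

-- Truncated subtraction occurs only in the exponents, so the formulas are the
-- intended ones when k ≥ 3; the quotient by 4 is exact division in ℚ.
closedForm : ℕ → Fin 3 → ℚ
closedForm k zero =
  (+ 121 ℤ.* + (3 ^ (k ∸ 2)) ℤ.- + 2 ℤ.* + k ℤ.+ + 7) ℚ./ 4
closedForm k (suc zero) =
  (+ 529 ℤ.* + (3 ^ (k ∸ 3)) ℤ.- + 2 ℤ.* + k ℤ.+ + 25) ℚ./ 4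
closedForm k (suc (suc zero)) =
  (+ 253 ℤ.* + (3 ^ (k ∸ 2)) ℤ.- + 2 ℤ.* + k ℤ.+ + 15) ℚ./ 4

{-# OPTIONS --safe #-}
module Submission where

-- Let p(v) be the number of paths that start at v, so p(v) is 1 plus the sum
-- of p(target e) over the edges e leaving v, and the sum of all p(v) is to be
-- maximised.  List the vertices by increasing p.  If M is the largest value
-- before v and v has a outgoing edges, then p(v) ≤ 1 + a * M.  This suggests a
-- one-player game with N units: start from the number 1, repeatedly spend
-- a ≥ 1 units to turn the current number M into 1 + a * M, and score the sum of
-- all numbers met (`total N 1`).  A chain of vertices in which neighbours are
-- joined by a₁, a₂, ... parallel edges realises a play exactly, so the maximum
-- of the game is attained by a graph.
--
-- It is also an upper bound (`paths≤total`), because extra sinks do not pay: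
-- by connectedness each sink has an incoming edge.  When the sink's single
-- trivial path is charged to the start of such an edge, the edge carries at
-- most 2 rather than M, which is no gain as soon as M ≥ 2.  Only the first
-- vertex with outgoing edges sees M = 1, and there the charge is beaten by
-- playing 1 and then a - 1 (`first-charge`).
--
-- The game is solved in two ranges.  From M ≥ 11 on, one word of moves is best
-- for all M: threes, then a tail of twos and a one that depends on the number
-- of units mod 3 (`total≤best`).  Its score is linear in M, which turns the
-- claim into comparisons of two affine functions.  Below 11 the best play does
-- depend on M, but 1 + a * M exceeds M, so only finitely many openings remain; each is compared with the optimal opening 1, 2, 2 or 1, 2, 3 by a
-- search whose outcome is valid for all longer games in the same residue class
-- (`Certificate`).  Such comparisons over infinitely many lengths are finite,
-- because prepending a three to both words preserves them (`dominated-grow`).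
--
-- The vertex type is arbitrary.  Its equality is decidable because a walk from a
-- fixed vertex, written as the list of its labelled steps, determines where it
-- ends, and connectedness selects one walk to each vertex (`Discreteness`).

open import Defs
open import Axiom.UniquenessOfIdentityProofs.WithK using (uip)
open import Data.Bool using (true; false; if_then_else_)
open import Data.Empty using (⊥; ⊥-elim)
open import Data.Fin as Fin using (Fin; zero; suc; toℕ)
open import Data.Fin.Induction using (spo-noetherian)
open import Data.Fin.Permutation using (↔⇒≡)
open import Data.Fin.Properties using (0↔⊥; 1↔⊤; +↔⊎; *↔×)
open import Data.Integer as ℤ using (+_)
import Data.Integer.Properties as ℤ
import Data.Integer.Tactic.RingSolver as ℤ-Solver
open import Data.List
  using (List; []; _∷_; _++_; map; length; lookup; tabulate; deduplicate; initLast; _∷ʳ′_)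
import Data.List.Properties as List
open import Data.List.NonEmpty using (_∷_; last)
open import Data.List.Membership.Propositional using (_∈_)
open import Data.List.Membership.Propositional.Properties
  using (∈-map⁺; ∈-++⁺ˡ; ∈-++⁺ʳ; ∈-lookup; ∈-tabulate⁺; ∈-deduplicate⁺)
open import Data.List.Relation.Binary.Permutation.Propositional using (↭-sym)
import Data.List.Relation.Binary.Permutation.Propositional.Properties as Perm
open import Data.List.Relation.Unary.All as All using (All; []; _∷_)
open import Data.List.Relation.Unary.AllPairs using (AllPairs; []; _∷_)
open import Data.List.Relation.Unary.Any using (here; there; index)
open import Data.List.Relation.Unary.Any.Properties using (lookup-index)
open import Data.List.Relation.Unary.Linked using (Linked; [-]; _∷_)
open import Data.List.Relation.Unary.Linked.Properties using (Linked⇒AllPairs)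
open import Data.List.Relation.Unary.Unique.DecPropositional.Properties using (deduplicate-!)
open import Data.List.Relation.Unary.Unique.Propositional using (Unique)
import Data.List.Relation.Unary.Unique.Propositional.Properties as Unique
open import Data.List.Sort using (sort; sort-↭; sort-↗)
open import Data.Maybe using (Maybe; just; nothing; from-just; _<∣>_)
open import Data.Nat
  using (ℕ; zero; suc; _+_; _*_; _^_; _∸_; _⊔_; _≤_; _<_; _≥_; z≤n; s≤s; _≤?_; _<?_)
open import Data.Nat.Induction using (<-rec)
open import Data.Nat.ListAction using (sum)
open import Data.Nat.ListAction.Properties using (sum-↭)
open import Data.Nat.Properties hiding (_≟_)
open import Data.Nat.Tactic.RingSolver using (solve-∀)
open import Data.Product using (Σ; ∃-syntax; _×_; _,_; proj₁; proj₂)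
import Data.Product.Function.Dependent.Propositional as Σ-cong
open import Data.Product.Function.NonDependent.Propositional using (_×-↔_)
open import Data.Rational using (_/_)
open import Data.Rational.Properties using (fromℚᵘ-cong)
open import Data.Rational.Unnormalised using (mkℚᵘ; *≡*)
open import Data.Sum using (_⊎_; inj₁; inj₂)
import Data.Sum.Properties as Sum
open import Data.Sum.Function.Propositional using (_⊎-↔_)
open import Data.Unit using (⊤; tt)
open import Function using (_∘_; const; flip)
open import Function.Bundles using (_↔_; mk↔ₛ′; mk↣; Inverse; Injection)
open import Function.Construct.Composition using (_↔-∘_)
open import Function.Construct.Identity using (↔-id)
open import Function.Construct.Symmetry using (↔-sym)
open import Function.Properties.Inverse using (↔⇒↣)
open import Induction.WellFounded using (Acc; acc)
open import Relation.Binary.Construct.Closure.Equivalence as Eq using (EqClosure)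
open import Relation.Binary.Construct.Closure.ReflexiveTransitive using (Star; ε; _◅_; _◅◅_)
open import Relation.Binary.Construct.Closure.Symmetric using (SymClosure; fwd; bwd)
open import Relation.Binary.Construct.Closure.Transitive as Plus using (TransClosure; [_]; _∷_)
import Relation.Binary.Construct.On as On
open import Relation.Binary.Definitions using (DecidableEquality)
open import Relation.Binary.PropositionalEquality
  using (_≡_; _≢_; refl; sym; trans; cong; cong₂; subst; isEquivalence; resp₂; module ≡-Reasoning)
open import Relation.Binary.Structures using (IsStrictPartialOrder)
open import Relation.Nullary using (Dec; yes; no; does; ¬_; contradiction)
open import Relation.Nullary.Decidable
  using (map′; _×-dec_; from-yes; dec-true; dec-false; via-injection)

-- The multiplication game

-- `total e M` is the best score with e units from the number M, and `gain e M`
-- leaves out M itself.  Only the moves 1, 2 and 3 are tried, since larger ones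
-- never help (`gain-step`).
mutual
  gain : ℕ → ℕ → ℕ
  gain 0                   M = 0
  gain 1                   M = total 0 (1 + 1 * M)
  gain 2                   M = total 1 (1 + 1 * M) ⊔ total 0 (1 + 2 * M)
  gain (suc (suc (suc e))) M =
    total (suc (suc e)) (1 + 1 * M) ⊔ (total (suc e) (1 + 2 * M) ⊔ total e (1 + 3 * M))

  total : ℕ → ℕ → ℕ
  total e M = M + gain e M

gain-mono : ∀ e {M M′} → M ≤ M′ → gain e M ≤ gain e M′
total-mono : ∀ e {M M′} → M ≤ M′ → total e M ≤ total e M′

total-mono e M≤ = +-mono-≤ M≤ (gain-mono e M≤)

gain-mono 0 M≤ = z≤n
gain-mono 1 M≤ = total-mono 0 (s≤s (*-monoʳ-≤ 1 M≤))
gain-mono 2 M≤ = ⊔-mono-≤ (total-mono 1 (s≤s (*-monoʳ-≤ 1 M≤)))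
                          (total-mono 0 (s≤s (*-monoʳ-≤ 2 M≤)))
gain-mono (suc (suc (suc e))) M≤ =
  ⊔-mono-≤ (total-mono (suc (suc e)) (s≤s (*-monoʳ-≤ 1 M≤)))
    (⊔-mono-≤ (total-mono (suc e) (s≤s (*-monoʳ-≤ 2 M≤)))
              (total-mono e (s≤s (*-monoʳ-≤ 3 M≤))))

-- A move of 4 + a units is no better than a move of 2 followed by one of 2 + a:
-- that pair reaches at least the same number and scores one number more.
gain-step : ∀ a e M → total e (1 + suc a * M) ≤ gain (suc a + e) M
gain-step 0 0 M = ≤-refl
gain-step 0 1 M = m≤m⊔n (total 1 (1 + 1 * M)) (total 0 (1 + 2 * M))
gain-step 0 (suc (suc e)) M =
  m≤m⊔n (total (2 + e) (1 + 1 * M)) (total (1 + e) (1 + 2 * M) ⊔ total e (1 + 3 * M))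
gain-step 1 0 M = m≤n⊔m (total 1 (1 + 1 * M)) (total 0 (1 + 2 * M))
gain-step 1 (suc e) M = ≤-trans (m≤m⊔n (total (1 + e) (1 + 2 * M)) (total e (1 + 3 * M)))
                                (m≤n⊔m (total (2 + e) (1 + 1 * M)) _)
gain-step 2 e M = ≤-trans (m≤n⊔m (total (1 + e) (1 + 2 * M)) (total e (1 + 3 * M)))
                          (m≤n⊔m (total (2 + e) (1 + 1 * M)) _)
gain-step (suc (suc (suc a))) e M = begin
  total e (1 + (4 + a) * M)                        ≤⟨ total-mono e (s≤s widen) ⟩
  total e (1 + (2 + a) * (1 + 2 * M))              ≤⟨ gain-step (suc a) e (1 + 2 * M) ⟩
  gain (2 + a + e) (1 + 2 * M)                     ≤⟨ m≤n+m _ _ ⟩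
  total (2 + a + e) (1 + 2 * M)                    ≤⟨ gain-step 1 (2 + a + e) M ⟩
  gain (4 + a + e) M                               ∎
  where
  open ≤-Reasoning
  widen : (4 + a) * M ≤ (2 + a) * (1 + 2 * M)
  widen = ≤-trans (m≤m+n _ (2 + a + a * M)) (≤-reflexive (eq a M))
    where
    eq : ∀ a M → (4 + a) * M + (2 + a + a * M) ≡ (2 + a) * (1 + 2 * M)
    eq = solve-∀

-- Playing a word of moves from M scores M * β + γ in total.  The pair (β , γ)
-- also counts paths: in the chain whose multiplicities are the letters of the
-- word, β paths start at the first vertex and γ elsewhere.
Profile : Set
Profile = ℕ × ℕ

grow : ℕ → Profile → Profile
grow a (β , γ) = 1 + a * β , β + γ

profile : List ℕ → Profile
profile []      = 1 , 0
profile (a ∷ w) = grow a (profile w)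

-- The best play from every M ≥ 11.  Large multiplicities belong next to large
-- numbers, so the threes come first; periodicity sets in at length 5.
bestWord : ℕ → List ℕ
bestWord 0 = []
bestWord 1 = 1 ∷ []
bestWord 2 = 1 ∷ 1 ∷ []
bestWord 3 = 2 ∷ 1 ∷ []
bestWord 4 = 2 ∷ 1 ∷ 1 ∷ []
bestWord 5 = 2 ∷ 2 ∷ 1 ∷ []
bestWord 6 = 3 ∷ 2 ∷ 1 ∷ []
bestWord 7 = 2 ∷ 2 ∷ 2 ∷ 1 ∷ []
bestWord (suc (suc (suc (suc (suc (suc (suc (suc e)))))))) =
  3 ∷ bestWord (suc (suc (suc (suc (suc e)))))

best : ℕ → Profile
best e = profile (bestWord e)

best-periodic : ∀ {e} → 5 ≤ e → best (3 + e) ≡ grow 3 (best e)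
best-periodic (s≤s (s≤s (s≤s (s≤s (s≤s z≤n))))) = refl

-- The final score when A has been scored so far, the current number is M, and
-- the remaining moves have profile (β , γ).
value : ℕ → ℕ → Profile → ℕ
value A M (β , γ) = A + (M * β + γ)

-- Prepending a three to the remaining moves changes the value by half of this
-- product (up to the constant 1) and triples the product itself.
rate : ℕ → Profile → ℕ
rate M (β , γ) = (1 + 2 * M) * (1 + 2 * β)

value-grow : ∀ A M l → 1 + 2 * value A M (grow 3 l) ≡ 2 * value A M l + rate M l
value-grow A M (β , γ) = eq A M β γ
  where
  eq : ∀ A M β γ → 1 + 2 * (A + (M * (1 + 3 * β) + (β + γ))) ≡
                   2 * (A + (M * β + γ)) + (1 + 2 * M) * (1 + 2 * β)
  eq = solve-∀

rate-grow : ∀ M l → rate M (grow 3 l) ≡ 3 * rate M l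
rate-grow M (β , γ) = eq M β
  where
  eq : ∀ M β → (1 + 2 * M) * (1 + 2 * (1 + 3 * β)) ≡ 3 * ((1 + 2 * M) * (1 + 2 * β))
  eq = solve-∀

-- Two inequalities at one length that force the first one at all lengths that
-- arise by prepending threes.
record Dominated (A M : ℕ) (l : Profile) (A′ M′ : ℕ) (l′ : Profile) : Set where
  constructor dominated
  field
    value≤ : value A M l ≤ value A′ M′ l′
    rate≤  : rate M l ≤ rate M′ l′
open Dominated

dominated? : ∀ A M l A′ M′ l′ → Dec (Dominated A M l A′ M′ l′)
dominated? A M l A′ M′ l′ =
  map′ (λ (v , r) → dominated v r) (λ d → value≤ d , rate≤ d)
       (value A M l ≤? value A′ M′ l′ ×-dec rate M l ≤? rate M′ l′)

dominated-grow : ∀ {A M l A′ M′ l′} → Dominated A M l A′ M′ l′ →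
                 Dominated A M (grow 3 l) A′ M′ (grow 3 l′)
dominated-grow {A} {M} {l} {A′} {M′} {l′} d = dominated
  (*-cancelˡ-≤ 2 (≤-pred (begin
    1 + 2 * value A M (grow 3 l)        ≡⟨ value-grow A M l ⟩
    2 * value A M l + rate M l          ≤⟨ +-mono-≤ (*-monoʳ-≤ 2 (value≤ d)) (rate≤ d) ⟩
    2 * value A′ M′ l′ + rate M′ l′     ≡⟨ value-grow A′ M′ l′ ⟨
    1 + 2 * value A′ M′ (grow 3 l′)     ∎)))
  (begin
    rate M (grow 3 l)    ≡⟨ rate-grow M l ⟩
    3 * rate M l         ≤⟨ *-monoʳ-≤ 3 (rate≤ d) ⟩
    3 * rate M′ l′       ≡⟨ rate-grow M′ l′ ⟨
    rate M′ (grow 3 l′)  ∎)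
  where open ≤-Reasoning

dominated-periodic : ∀ {A M e A′ M′ e′} → 5 ≤ e → 5 ≤ e′ →
  Dominated A M (best e) A′ M′ (best e′) → ∀ n →
  Dominated A M (best (n * 3 + e)) A′ M′ (best (n * 3 + e′))
dominated-periodic h h′ d zero    = d
dominated-periodic {A} {M} {e} {A′} {M′} {e′} h h′ d (suc n)
  rewrite best-periodic (≤-trans h (m≤n+m e (n * 3)))
        | best-periodic (≤-trans h′ (m≤n+m e′ (n * 3))) =
  dominated-grow (dominated-periodic h h′ d n)

-- Optimal play from large numbers

-- Playing a and then the best word for e units is no better than the best word
-- for a + e units, for every M ≥ 11: both scores are affine in M, so it suffices
-- to compare slopes and the scores at M = 11.  The bound 11 is sharp, because
-- there 2 ∷ 3 ∷ 2 ∷ 2 ∷ 1 ∷ [] and 3 ∷ 2 ∷ 2 ∷ 2 ∷ 1 ∷ [] tie, and from smaller M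
-- the former wins.
record Extends (a : ℕ) (l l′ : Profile) : Set where
  constructor extends
  field
    slope≤ : 1 + a * proj₁ l ≤ proj₁ l′
    at11≤  : Dominated 11 (1 + a * 11) l 0 11 l′
open Extends

extends? : ∀ a l l′ → Dec (Extends a l l′)
extends? a l l′ = map′ (λ (s , d) → extends s d) (λ x → slope≤ x , at11≤ x)
  (1 + a * proj₁ l ≤? proj₁ l′ ×-dec dominated? 11 (1 + a * 11) l 0 11 l′)

extends-grow : ∀ {a l l′} → a ≤ 3 → Extends a l l′ → Extends a (grow 3 l) (grow 3 l′)
extends-grow {a} {β , γ} {β′ , γ′} a≤3 x = extends
  (s≤s (begin
    a * (1 + 3 * β)    ≡⟨ eq a β ⟩
    a + 3 * (a * β)    ≤⟨ +-monoˡ-≤ _ a≤3 ⟩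
    3 + 3 * (a * β)    ≡⟨ *-suc 3 (a * β) ⟨
    3 * (1 + a * β)    ≤⟨ *-monoʳ-≤ 3 (slope≤ x) ⟩
    3 * β′             ∎))
  (dominated-grow (at11≤ x))
  where
  open ≤-Reasoning
  eq : ∀ a β → a * (1 + 3 * β) ≡ a + 3 * (a * β)
  eq = solve-∀

-- A three prepended to both best words carries the comparison from 5 + e to
-- 8 + e, which leaves the lengths below 8 to be checked by evaluation.
best-extends : ∀ {a} → a ≤ 3 → (∀ {e} → e < 8 → Extends a (best e) (best (a + e))) →
               ∀ e → Extends a (best e) (best (a + e))
best-extends {a} a≤3 small = <-rec _ go
  where
  periodic : ∀ e → best (a + (8 + e)) ≡ grow 3 (best (a + (5 + e)))
  periodic e = trans (cong best (eq a e))
                     (best-periodic (≤-trans (m≤m+n 5 e) (m≤n+m (5 + e) a)))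
    where
    eq : ∀ a e → a + (8 + e) ≡ 3 + (a + (5 + e))
    eq = solve-∀

  go : ∀ e → (∀ {d} → d < e → Extends a (best d) (best (a + d))) →
       Extends a (best e) (best (a + e))
  go e rec with e <? 8
  ... | yes e<8 = small e<8
  ... | no  e≮8 with e ∸ 8 | m+[n∸m]≡n (≮⇒≥ e≮8)
  ... | e′ | refl = subst (Extends a (best (8 + e′))) (sym (periodic e′))
                          (extends-grow a≤3 (rec (m≤n+m (6 + e′) 2)))

best-extends₁ : ∀ e → Extends 1 (best e) (best (1 + e))
best-extends₁ = best-extends (s≤s z≤n)
  (from-yes (allUpTo? (λ e → extends? 1 (best e) (best (1 + e))) 8))

best-extends₂ : ∀ e → Extends 2 (best e) (best (2 + e))
best-extends₂ = best-extends (s≤s (s≤s z≤n))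
  (from-yes (allUpTo? (λ e → extends? 2 (best e) (best (2 + e))) 8))

best-extends₃ : ∀ e → Extends 3 (best e) (best (3 + e))
best-extends₃ = best-extends ≤-refl
  (from-yes (allUpTo? (λ e → extends? 3 (best e) (best (3 + e))) 8))

extends-bound : ∀ {a M l l′} → 11 ≤ M → Extends a l l′ →
                value M (1 + a * M) l ≤ value 0 M l′
extends-bound {a} {M} {β , γ} {β′ , γ′} 11≤M x
  with M ∸ 11 | m+[n∸m]≡n 11≤M
... | d | refl = begin
  value (11 + d) (1 + a * (11 + d)) (β , γ)         ≡⟨ eq a d β γ ⟩
  value 11 (1 + a * 11) (β , γ) + d * (1 + a * β)   ≤⟨ +-mono-≤ (value≤ (at11≤ x)) (*-monoʳ-≤ d (slope≤ x)) ⟩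
  value 0 11 (β′ , γ′) + d * β′                     ≡⟨ eq′ d β′ γ′ ⟩
  value 0 (11 + d) (β′ , γ′)                        ∎
  where
  open ≤-Reasoning
  eq : ∀ a d β γ → (11 + d) + ((1 + a * (11 + d)) * β + γ) ≡
                   11 + ((1 + a * 11) * β + γ) + d * (1 + a * β)
  eq = solve-∀
  eq′ : ∀ d β γ → (11 * β + γ) + d * β ≡ (11 + d) * β + γ
  eq′ = solve-∀

total≤best : ∀ e {M} → 11 ≤ M → total e M ≤ value 0 M (best e)
via : ∀ a e {M} → 11 ≤ M → Extends (suc a) (best e) (best (suc a + e)) →
      M + total e (1 + suc a * M) ≤ value 0 M (best (suc a + e))

via a e {M} h x = ≤-trans
  (+-monoʳ-≤ M (total≤best e (≤-trans h (≤-trans (m≤m+n M (a * M)) (n≤1+n _)))))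
  (extends-bound h x)

total≤best 0 {M} h = ≤-reflexive (cong (_+ 0) (sym (*-identityʳ M)))
total≤best 1 h = via 0 0 h (best-extends₁ 0)
total≤best 2 {M} h = begin
  M + (total 1 (1 + 1 * M) ⊔ total 0 (1 + 2 * M)) ≡⟨ +-distribˡ-⊔ M _ _ ⟩
  (M + total 1 (1 + 1 * M)) ⊔ (M + total 0 (1 + 2 * M))
    ≤⟨ ⊔-lub (via 0 1 h (best-extends₁ 1)) (via 1 0 h (best-extends₂ 0)) ⟩
  value 0 M (best 2) ∎
  where open ≤-Reasoning
total≤best (suc (suc (suc e))) {M} h = begin
  M + (total (2 + e) (1 + 1 * M) ⊔ (total (1 + e) (1 + 2 * M) ⊔ total e (1 + 3 * M)))
    ≡⟨ trans (+-distribˡ-⊔ M _ _) (cong (M + total (2 + e) (1 + 1 * M) ⊔_) (+-distribˡ-⊔ M _ _)) ⟩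
  (M + total (2 + e) (1 + 1 * M)) ⊔ ((M + total (1 + e) (1 + 2 * M)) ⊔ (M + total e (1 + 3 * M)))
    ≤⟨ ⊔-lub (via 0 (suc (suc e)) h (best-extends₁ (2 + e)))
        (⊔-lub (via 1 (suc e) h (best-extends₂ (1 + e))) (via 2 e h (best-extends₃ e))) ⟩
  value 0 M (best (3 + e)) ∎
  where open ≤-Reasoning

-- Optimal play from small numbers

module _ (A′ M′ e′ : ℕ) where

  -- A finite proof that, for every n, no play with n * 3 + e units from the
  -- number M with score A so far beats a target that has n * 3 + e′ units left
  -- in its large-number phase.  At a leaf, n = 0 is compared separately: the best
  -- words are periodic from length 5 only, and 2 ≤ e gives 5 ≤ 3 + e.
  data Certificate : ℕ → ℕ → ℕ → Set where
    leaf   : ∀ {A M e} → 11 ≤ M → 2 ≤ e →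
             Dominated A M (best e) A′ M′ (best e′) →
             Dominated A M (best (3 + e)) A′ M′ (best (3 + e′)) →
             Certificate A M e
    branch : ∀ {A M e} →
             Certificate (A + M) (1 + 1 * M) (2 + e) →
             Certificate (A + M) (1 + 2 * M) (1 + e) →
             Certificate (A + M) (1 + 3 * M) e →
             Certificate A M (3 + e)

  leaf? : ∀ A M e → Maybe (Certificate A M e)
  leaf? A M e with 11 ≤? M | 2 ≤? e | dominated? A M (best e) A′ M′ (best e′)
                 | dominated? A M (best (3 + e)) A′ M′ (best (3 + e′))
  ... | yes p | yes q | yes r | yes s = just (leaf p q r s)
  ... | _     | _     | _     | _     = nothing

  certify : ℕ → ∀ A M e → Maybe (Certificate A M e)
  certify (suc f) A M (suc (suc (suc e))) = leaf? A M (3 + e) <∣> node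
    where
    node : Maybe (Certificate A M (3 + e))
    node with certify f (A + M) (1 + 1 * M) (2 + e)
            | certify f (A + M) (1 + 2 * M) (1 + e)
            | certify f (A + M) (1 + 3 * M) e
    ... | just p | just q | just r = just (branch p q r)
    ... | _      | _      | _      = nothing
  certify _ A M e = nothing

  sound : 2 ≤ e′ → ∀ {A M e} → Certificate A M e → ∀ n →
          A + total (n * 3 + e) M ≤ value A′ M′ (best (n * 3 + e′))
  sound 2≤e′ {A} {M} {e} (leaf 11≤M 2≤e d d₃) n = begin
    A + total (n * 3 + e) M              ≤⟨ +-monoʳ-≤ A (total≤best (n * 3 + e) 11≤M) ⟩
    value A M (best (n * 3 + e))         ≤⟨ at n ⟩
    value A′ M′ (best (n * 3 + e′))      ∎
    where
    open ≤-Reasoning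
    shift : ∀ n e → n * 3 + (3 + e) ≡ suc n * 3 + e
    shift = solve-∀
    at : ∀ n → value A M (best (n * 3 + e)) ≤ value A′ M′ (best (n * 3 + e′))
    at zero    = value≤ d
    at (suc n) rewrite sym (shift n e) | sym (shift n e′) =
      value≤ (dominated-periodic (+-monoʳ-≤ 3 2≤e) (+-monoʳ-≤ 3 2≤e′) d₃ n)
  sound 2≤e′ {A} {M} (branch {e = e} p q r) n = begin
    A + total (n * 3 + (3 + e)) M
      ≡⟨ cong (λ x → A + total x M) (shift n e) ⟩
    A + (M + gain (3 + (n * 3 + e)) M)
      ≡⟨ +-assoc A M _ ⟨
    A + M + gain (3 + (n * 3 + e)) M
      ≡⟨ trans (+-distribˡ-⊔ (A + M) _ _)
               (cong (A + M + total (2 + (n * 3 + e)) (1 + 1 * M) ⊔_) (+-distribˡ-⊔ (A + M) _ _)) ⟩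
    (A + M + total (2 + (n * 3 + e)) (1 + 1 * M)) ⊔
      ((A + M + total (1 + (n * 3 + e)) (1 + 2 * M)) ⊔ (A + M + total (n * 3 + e) (1 + 3 * M)))
      ≤⟨ ⊔-lub (below (shift₂ n e) (sound 2≤e′ p n))
               (⊔-lub (below (shift₁ n e) (sound 2≤e′ q n)) (sound 2≤e′ r n)) ⟩
    value A′ M′ (best (n * 3 + e′)) ∎
    where
    open ≤-Reasoning
    shift : ∀ n e → n * 3 + (3 + e) ≡ 3 + (n * 3 + e)
    shift = solve-∀
    shift₂ : ∀ n e → n * 3 + (2 + e) ≡ 2 + (n * 3 + e)
    shift₂ = solve-∀
    shift₁ : ∀ n e → n * 3 + (1 + e) ≡ 1 + (n * 3 + e)
    shift₁ = solve-∀
    below : ∀ {x y L B} → x ≡ y → A + M + total x L ≤ B → A + M + total y L ≤ B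
    below refl h = h

-- The targets open with 1, 2, 2 or 1, 2, 3: this passes the numbers 1, 2, 5, so
-- scores 8, and reaches 11 or 16.  The search depth 13 is ample, since from 1 the
-- number reaches 11 within ten moves.
total-bound₁₆ : ∀ n → total (n * 3 + 16) 1 ≤ value 8 11 (best (n * 3 + 11))
total-bound₁₆ = sound 8 11 11 (s≤s (s≤s z≤n)) (from-just (certify 8 11 11 13 0 1 16))

total-bound₁₇ : ∀ n → total (n * 3 + 17) 1 ≤ value 8 11 (best (n * 3 + 12))
total-bound₁₇ = sound 8 11 12 (s≤s (s≤s z≤n)) (from-just (certify 8 11 12 13 0 1 17))

total-bound₁₈ : ∀ n → total (n * 3 + 18) 1 ≤ value 8 16 (best (n * 3 + 12))
total-bound₁₈ = sound 8 16 12 (s≤s (s≤s z≤n)) (from-just (certify 8 16 12 13 0 1 18))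

-- The values of the optimal words

sum-bestWord : ∀ e → sum (bestWord e) ≡ e
sum-bestWord 0 = refl
sum-bestWord 1 = refl
sum-bestWord 2 = refl
sum-bestWord 3 = refl
sum-bestWord 4 = refl
sum-bestWord 5 = refl
sum-bestWord 6 = refl
sum-bestWord 7 = refl
sum-bestWord (suc (suc (suc (suc (suc (suc (suc (suc e)))))))) =
  cong (λ s → 3 + s) (sum-bestWord (suc (suc (suc (suc (suc e))))))

pathCount : List ℕ → ℕ
pathCount w = proj₁ (profile w) + proj₂ (profile w)

-- A word scores its path count when played from M = 1; the opening 1, 2, 2 then
-- passes the numbers 1, 2, 5 and reaches 11.
pathCount-122 : ∀ w → pathCount (1 ∷ 2 ∷ 2 ∷ w) ≡ value 8 11 (profile w)
pathCount-122 w = eq (proj₁ (profile w)) (proj₂ (profile w))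
  where
  eq : ∀ β γ → 1 + 1 * (1 + 2 * (1 + 2 * β)) +
               (1 + 2 * (1 + 2 * β) + (1 + 2 * β + (β + γ))) ≡ 8 + (11 * β + γ)
  eq = solve-∀

pathCount-123 : ∀ w → pathCount (1 ∷ 2 ∷ 3 ∷ w) ≡ value 8 16 (profile w)
pathCount-123 w = eq (proj₁ (profile w)) (proj₂ (profile w))
  where
  eq : ∀ β γ → 1 + 1 * (1 + 2 * (1 + 3 * β)) +
               (1 + 2 * (1 + 3 * β) + (1 + 3 * β + (β + γ))) ≡ 8 + (16 * β + γ)
  eq = solve-∀

rate-periodic : ∀ M {e} → 5 ≤ e → ∀ n → rate M (best (n * 3 + e)) ≡ 3 ^ n * rate M (best e)
rate-periodic M 5≤e zero = sym (+-identityʳ _)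
rate-periodic M {e} 5≤e (suc n) = begin
  rate M (best (3 + (n * 3 + e)))          ≡⟨ cong (rate M) (best-periodic (≤-trans 5≤e (m≤n+m e (n * 3)))) ⟩
  rate M (grow 3 (best (n * 3 + e)))       ≡⟨ rate-grow M (best (n * 3 + e)) ⟩
  3 * rate M (best (n * 3 + e))            ≡⟨ cong (3 *_) (rate-periodic M 5≤e n) ⟩
  3 * (3 ^ n * rate M (best e))            ≡⟨ *-assoc 3 (3 ^ n) _ ⟨
  3 ^ suc n * rate M (best e)              ∎
  where open ≡-Reasoning

-- With vₙ and rₙ the value and the rate after n threes, 4 vₙ₊₁ + 2 = 4 vₙ + 2 rₙ
-- and rₙ = 3 ^ n * r₀; this is the solution of that recurrence.
value-closed : ∀ A M {e} → 5 ≤ e → ∀ n →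
  4 * value A M (best (n * 3 + e)) + 2 * n + rate M (best e) ≡
  4 * value A M (best e) + 3 ^ n * rate M (best e)
value-closed A M {e} 5≤e zero =
  cong₂ _+_ (+-identityʳ (4 * value A M (best e))) (sym (+-identityʳ (rate M (best e))))
value-closed A M {e} 5≤e (suc n) = begin
  4 * value A M (best (3 + (n * 3 + e))) + 2 * suc n + R
    ≡⟨ cong (λ l → 4 * value A M l + 2 * suc n + R) (best-periodic (≤-trans 5≤e (m≤n+m e (n * 3)))) ⟩
  4 * value A M (grow 3 lₙ) + 2 * suc n + R
    ≡⟨ eq₁ (value A M (grow 3 lₙ)) n R ⟩
  2 * (1 + 2 * value A M (grow 3 lₙ)) + 2 * n + R
    ≡⟨ cong (λ x → 2 * x + 2 * n + R) (value-grow A M lₙ) ⟩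
  2 * (2 * value A M lₙ + rate M lₙ) + 2 * n + R
    ≡⟨ eq₂ (value A M lₙ) (rate M lₙ) n R ⟩
  (4 * value A M lₙ + 2 * n + R) + 2 * rate M lₙ
    ≡⟨ cong₂ (λ x y → x + 2 * y) (value-closed A M 5≤e n) (rate-periodic M 5≤e n) ⟩
  4 * value A M (best e) + 3 ^ n * R + 2 * (3 ^ n * R)
    ≡⟨ eq₃ (value A M (best e)) (3 ^ n) R ⟩
  4 * value A M (best e) + 3 ^ suc n * R ∎
  where
  open ≡-Reasoning
  lₙ = best (n * 3 + e)
  R  = rate M (best e)
  eq₁ : ∀ v n R → 4 * v + 2 * (1 + n) + R ≡ 2 * (1 + 2 * v) + 2 * n + R
  eq₁ = solve-∀
  eq₂ : ∀ v r n R → 2 * (2 * v + r) + 2 * n + R ≡ 4 * v + 2 * n + R + 2 * r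
  eq₂ = solve-∀
  eq₃ : ∀ v t R → 4 * v + t * R + 2 * (t * R) ≡ 4 * v + (3 * t) * R
  eq₃ = solve-∀

quarter : ∀ P x y k c → 4 * P + 2 * k ≡ x * y + c →
          + P / 1 ≡ (+ x ℤ.* + y ℤ.- + 2 ℤ.* + k ℤ.+ + c) / 4
quarter P x y k c h = fromℚᵘ-cong {mkℚᵘ (+ P) 0} {mkℚᵘ (+ x ℤ.* + y ℤ.- + 2 ℤ.* + k ℤ.+ + c) 3} (*≡* (begin
  + P ℤ.* + 4
    ≡⟨ eq₁ (+ P) (+ k) ⟩
  (+ 4 ℤ.* + P ℤ.+ + 2 ℤ.* + k) ℤ.- + 2 ℤ.* + k
    ≡⟨ cong (ℤ._- + 2 ℤ.* + k) lifted ⟩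
  (+ x ℤ.* + y ℤ.+ + c) ℤ.- + 2 ℤ.* + k
    ≡⟨ eq₂ (+ x ℤ.* + y) (+ k) (+ c) ⟩
  (+ x ℤ.* + y ℤ.- + 2 ℤ.* + k ℤ.+ + c) ℤ.* + 1 ∎))
  where
  open ≡-Reasoning
  eq₁ : ∀ p k → p ℤ.* + 4 ≡ (+ 4 ℤ.* p ℤ.+ + 2 ℤ.* k) ℤ.- + 2 ℤ.* k
  eq₁ = ℤ-Solver.solve-∀
  eq₂ : ∀ z k c → (z ℤ.+ c) ℤ.- + 2 ℤ.* k ≡ (z ℤ.- + 2 ℤ.* k ℤ.+ c) ℤ.* + 1
  eq₂ = ℤ-Solver.solve-∀
  lifted : + 4 ℤ.* + P ℤ.+ + 2 ℤ.* + k ≡ + x ℤ.* + y ℤ.+ + c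
  lifted = trans (cong₂ ℤ._+_ (sym (ℤ.pos-* 4 P)) (sym (ℤ.pos-* 2 k)))
                 (trans (cong +_ h) (cong (ℤ._+ + c) (ℤ.pos-* x y)))

-- Subtraction-free form of the closed formula; k is the quotient of the number
-- of edges by 3 at n = 0.
value-formula : ∀ A M {e} a j k c → 5 ≤ e → rate M (best e) ≡ a * 3 ^ j →
  4 * value A M (best e) + 2 * k ≡ rate M (best e) + c → ∀ n →
  4 * value A M (best (n * 3 + e)) + 2 * (k + n) ≡ a * 3 ^ (j + n) + c
value-formula A M {e} a j k c 5≤e rate≡ start n = +-cancelʳ-≡ R _ _ (begin
  4 * v + 2 * (k + n) + R                   ≡⟨ eq₁ v k n R ⟩
  (4 * v + 2 * n + R) + 2 * k               ≡⟨ cong (_+ 2 * k) (value-closed A M 5≤e n) ⟩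
  4 * value A M (best e) + 3 ^ n * R + 2 * k
    ≡⟨ eq₂ (value A M (best e)) (3 ^ n * R) k ⟩
  (4 * value A M (best e) + 2 * k) + 3 ^ n * R
    ≡⟨ cong₂ (λ x y → x + 3 ^ n * y) start rate≡ ⟩
  R + c + 3 ^ n * (a * 3 ^ j)               ≡⟨ eq₃ R c (3 ^ n) a (3 ^ j) ⟩
  a * (3 ^ j * 3 ^ n) + c + R               ≡⟨ cong (λ x → a * x + c + R) (^-distribˡ-+-* 3 j n) ⟨
  a * 3 ^ (j + n) + c + R                   ∎)
  where
  open ≡-Reasoning
  v = value A M (best (n * 3 + e))
  R = rate M (best e)
  eq₁ : ∀ v k n R → 4 * v + 2 * (k + n) + R ≡ (4 * v + 2 * n + R) + 2 * k
  eq₁ = solve-∀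
  eq₂ : ∀ v x k → 4 * v + x + 2 * k ≡ (4 * v + 2 * k) + x
  eq₂ = solve-∀
  eq₃ : ∀ R c t a s → R + c + t * (a * s) ≡ a * (s * t) + c + R
  eq₃ = solve-∀

formula₀ : ∀ n → 4 * value 8 16 (best (n * 3 + 12)) + 2 * (6 + n) ≡ 121 * 3 ^ (4 + n) + 7
formula₀ = value-formula 8 16 121 4 6 7 (from-yes (5 ≤? 12)) refl refl

formula₁ : ∀ n → 4 * value 8 11 (best (n * 3 + 11)) + 2 * (5 + n) ≡ 529 * 3 ^ (2 + n) + 25
formula₁ = value-formula 8 11 529 2 5 25 (from-yes (5 ≤? 11)) refl refl

formula₂ : ∀ n → 4 * value 8 11 (best (n * 3 + 12)) + 2 * (5 + n) ≡ 253 * 3 ^ (3 + n) + 15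
formula₂ = value-formula 8 11 253 3 5 15 (from-yes (5 ≤? 12)) refl refl

-- Finite sums and cardinalities

∑ : {A : Set} → List A → (A → ℕ) → ℕ
∑ xs f = sum (map f xs)

enumeration : ∀ {A n} → HasCardinality A n → List A
enumeration A↔n = tabulate (Inverse.from A↔n)

⊎-cardinality : ∀ {A B m n} → HasCardinality A m → HasCardinality B n →
                HasCardinality (A ⊎ B) (m + n)
⊎-cardinality A↔m B↔n = ↔-sym +↔⊎ ↔-∘ (A↔m ⊎-↔ B↔n)

Σ-Fin-cardinality : ∀ n (b : Fin n → ℕ) → HasCardinality (Σ (Fin n) (Fin ∘ b)) (sum (tabulate b))
Σ-Fin-cardinality zero    b = mk↔ₛ′ (λ ()) (λ ()) (λ ()) (λ ())
Σ-Fin-cardinality (suc n) b =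
  ⊎-cardinality (↔-id _) (Σ-Fin-cardinality n (b ∘ suc)) ↔-∘ split
  where
  split : Σ (Fin (suc n)) (Fin ∘ b) ↔ (Fin (b zero) ⊎ Σ (Fin n) (Fin ∘ b ∘ suc))
  split = mk↔ₛ′ (λ { (zero , x) → inj₁ x ; (suc i , x) → inj₂ (i , x) })
                (λ { (inj₁ x) → zero , x ; (inj₂ (i , x)) → suc i , x })
                (λ { (inj₁ x) → refl ; (inj₂ (i , x)) → refl })
                (λ { (zero , x) → refl ; (suc i , x) → refl })

Σ-cardinality : ∀ {A : Set} {B : A → Set} {n} (A↔n : HasCardinality A n) (b : A → ℕ) →
                (∀ a → HasCardinality (B a) (b a)) →
                HasCardinality (Σ A B) (∑ (enumeration A↔n) b)
Σ-cardinality {n = n} A↔n b B↔b =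
  subst (HasCardinality _) (cong sum (sym (List.map-tabulate (Inverse.from A↔n) b)))
    (Σ-Fin-cardinality n (b ∘ Inverse.from A↔n)
      ↔-∘ (Σ-cong.cong (↔-id _) (λ {i} → B↔b (Inverse.from A↔n i))
      ↔-∘ ↔-sym (Σ-cong.cong (↔-sym A↔n) (↔-id _))))

empty-cardinality : ∀ {A : Set} → ¬ A → HasCardinality A 0
empty-cardinality ¬a = mk↔ₛ′ (⊥-elim ∘ ¬a) (λ ()) (λ ()) (λ a → ⊥-elim (¬a a))

guard-cardinality : ∀ {P X : Set} {x} (p? : Dec P) → (∀ (p q : P) → p ≡ q) →
  HasCardinality X x → HasCardinality (P × X) (if does p? then x else 0)
guard-cardinality (no ¬p) irr X↔x = empty-cardinality (¬p ∘ proj₁)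
guard-cardinality (yes p) irr X↔x =
  X↔x ↔-∘ mk↔ₛ′ proj₂ (p ,_) (λ _ → refl) (λ (q , x) → cong (_, x) (irr p q))

lookup-injective : ∀ {A : Set} {xs : List A} → Unique xs → ∀ i j →
                   lookup xs i ≡ lookup xs j → i ≡ j
lookup-injective (x∉ ∷ u) zero    zero    eq = refl
lookup-injective (x∉ ∷ u) zero    (suc j) eq = contradiction eq (All.lookup x∉ (∈-lookup j))
lookup-injective (x∉ ∷ u) (suc i) zero    eq = contradiction (sym eq) (All.lookup x∉ (∈-lookup i))
lookup-injective (x∉ ∷ u) (suc i) (suc j) eq = cong suc (lookup-injective u i j eq)

unique⇒cardinality : ∀ {A : Set} {xs : List A} → Unique xs → (∀ a → a ∈ xs) →
                     HasCardinality A (length xs)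
unique⇒cardinality {xs = xs} u ∈xs = mk↔ₛ′ (index ∘ ∈xs) (lookup xs)
  (λ i → lookup-injective u _ i (sym (lookup-index (∈xs (lookup xs i)))))
  (λ a → sym (lookup-index (∈xs a)))

-- Paths as an inductive family

module Paths (G : DirectedGraph) where
  open DirectedGraph G

  -- Paths sorted by their first vertex.  Composability is built into the index,
  -- so a path unfolds into its first edge and the rest.
  data From : E⁰ → Set where
    stop : ∀ {v} → From v
    step : ∀ e → From (target e) → From (source e)

  private
    after : ∀ e es → Linked Consecutive (e ∷ es) → From (target e)
    after e []       [-]     = stop
    after e (f ∷ es) (r ∷ l) = subst From (sym r) (step f (after f es l))

    edges : ∀ e {v} → target e ≡ v → From v → Σ (List E¹) λ es → Linked Consecutive (e ∷ es)
    edges e r stop       = [] , [-]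
    edges e r (step f p) = f ∷ proj₁ (edges f refl p) , r ∷ proj₂ (edges f refl p)

    edges-subst : ∀ e {v} (r : target e ≡ v) p → edges e refl (subst From (sym r) p) ≡ edges e r p
    edges-subst e refl p = refl

    edges-after : ∀ e es l → edges e refl (after e es l) ≡ (es , l)
    edges-after e []       [-]     = refl
    edges-after e (f ∷ es) (r ∷ l) =
      trans (edges-subst e r (step f (after f es l)))
            (cong (λ (es , l) → f ∷ es , r ∷ l) (edges-after f es l))

    after-edges : ∀ e {v} (r : target e ≡ v) p →
                  after e (proj₁ (edges e r p)) (proj₂ (edges e r p)) ≡ subst From (sym r) p
    after-edges e r stop = subst-stop r
      where
      subst-stop : ∀ {u v} (r : u ≡ v) → stop ≡ subst From (sym r) stop
      subst-stop refl = refl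
    after-edges e r (step f p) = cong (λ q → subst From (sym r) (step f q)) (after-edges f refl p)

  FP↔From : FP ↔ Σ E⁰ From
  FP↔From = mk↔ₛ′ to from to∘from from∘to
    where
    to : FP → Σ E⁰ From
    to (inj₁ v)              = v , stop
    to (inj₂ (e ∷ es , l)) = source e , step e (after e es l)

    from : Σ E⁰ From → FP
    from (v , stop)      = inj₁ v
    from (_ , step e p)  = inj₂ (e ∷ proj₁ (edges e refl p) , proj₂ (edges e refl p))

    to∘from : ∀ p → to (from p) ≡ p
    to∘from (v , stop)     = refl
    to∘from (_ , step e p) = cong (λ q → source e , step e q) (after-edges e refl p)

    from∘to : ∀ p → from (to p) ≡ p
    from∘to (inj₁ v)            = refl
    from∘to (inj₂ (e ∷ es , l)) =
      cong (λ (es , l) → inj₂ (e ∷ es , l)) (edges-after e es l)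

  From-unfold : ∀ v → From v ↔ (⊤ ⊎ Σ E¹ λ e → source e ≡ v × From (target e))
  From-unfold v = mk↔ₛ′
    (λ { stop → inj₁ tt ; (step e p) → inj₂ (e , refl , p) })
    (λ { (inj₁ tt) → stop ; (inj₂ (e , refl , p)) → step e p })
    (λ { (inj₁ tt) → refl ; (inj₂ (e , refl , p)) → refl })
    (λ { stop → refl ; (step e p) → refl })

  last-∷ : ∀ (e f : E¹) es → last (e ∷ f ∷ es) ≡ last (f ∷ es)
  last-∷ e f es with initLast es
  ... | []       = refl
  ... | xs ∷ʳ′ x = refl

  closedPath : ∀ {e f} → TransClosure Consecutive e f →
               ∃[ es ] (Linked Consecutive (e ∷ es) × target (last (e ∷ es)) ≡ source f)
  closedPath [ r ] = [] , [-] , r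
  closedPath {e} (_∷_ {y = g} r rs) with closedPath rs
  ... | es , l , eq = g ∷ es , r ∷ l , trans (cong target (last-∷ e g es)) eq

-- Equality of vertices and finiteness of the path sets

-- The labels of a walk from u determine its end vertex, so that
-- v ↦ labels (connected u v) embeds the vertices into a discrete type.
module Discreteness (G : DirectedGraph)
  (_≟ᴱ_ : DecidableEquality (DirectedGraph.E¹ G)) (connected : DirectedGraph.Connected G) where
  open DirectedGraph G

  private
    labels : ∀ {u v} → Star (SymClosure _⟶_) u v → List (E¹ ⊎ E¹)
    labels ε                 = []
    labels (fwd (e , _) ◅ w) = inj₁ e ∷ labels w
    labels (bwd (e , _) ◅ w) = inj₂ e ∷ labels w

    labels-determine : ∀ {u v w} (p : Star (SymClosure _⟶_) u v) (q : Star (SymClosure _⟶_) u w) →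
                       labels p ≡ labels q → v ≡ w
    labels-determine ε ε eq = refl
    labels-determine ε (fwd x ◅ q) ()
    labels-determine ε (bwd x ◅ q) ()
    labels-determine (fwd x ◅ q) ε ()
    labels-determine (bwd x ◅ q) ε ()
    labels-determine (fwd (e , _ , refl) ◅ p) (fwd (f , _ , refl) ◅ q) eq
      with Sum.inj₁-injective (List.∷-injectiveˡ eq)
    ... | refl = labels-determine p q (List.∷-injectiveʳ eq)
    labels-determine (bwd (e , refl , _) ◅ p) (bwd (f , refl , _) ◅ q) eq
      with Sum.inj₂-injective (List.∷-injectiveˡ eq)
    ... | refl = labels-determine p q (List.∷-injectiveʳ eq)
    labels-determine (fwd x ◅ p) (bwd y ◅ q) eq with List.∷-injectiveˡ eq
    ... | ()
    labels-determine (bwd x ◅ p) (fwd y ◅ q) eq with List.∷-injectiveˡ eq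
    ... | ()

  infix 4 _≟_
  _≟_ : DecidableEquality E⁰
  u ≟ v = via-injection
    (mk↣ {to = labels ∘ connected u} (labels-determine (connected u _) (connected u _)))
    (List.≡-dec (Sum.≡-dec _≟ᴱ_ _≟ᴱ_)) u v

  -- A walk from v to the source of some edge either starts with an edge at v or
  -- is empty, and then v is that source.
  incident : E¹ → ∀ v → (∃[ e ] source e ≡ v) ⊎ (∃[ e ] target e ≡ v)
  incident e v with connected v (source e)
  ... | ε                        = inj₁ (e , refl)
  ... | fwd (f , f-from , _) ◅ _ = inj₁ (f , f-from)
  ... | bwd (f , _ , f-to) ◅ _   = inj₂ (f , f-to)

module OutSums (G : DirectedGraph) {N : ℕ}
  (E¹↔N : HasCardinality (DirectedGraph.E¹ G) N)
  (_≟_ : DecidableEquality (DirectedGraph.E⁰ G)) where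
  open DirectedGraph G

  edgeList : List E¹
  edgeList = enumeration E¹↔N

  ∈edgeList : ∀ e → e ∈ edgeList
  ∈edgeList e = subst (_∈ edgeList) (Inverse.strictlyInverseʳ E¹↔N e) (∈-tabulate⁺ (Inverse.to E¹↔N e))

  out : E⁰ → (E¹ → ℕ) → ℕ
  out v g = ∑ edgeList λ e → if does (source e ≟ v) then g e else 0

module Counting (G : DirectedGraph) {N : ℕ}
  (E¹↔N : HasCardinality (DirectedGraph.E¹ G) N)
  (_≟_ : DecidableEquality (DirectedGraph.E⁰ G))
  (acyclic : DirectedGraph.Acyclic G) where
  open DirectedGraph G
  open Paths G
  open OutSums G E¹↔N _≟_

  edge : Fin N → E¹
  edge = Inverse.from E¹↔N

  edge-index : ∀ e → edge (Inverse.to E¹↔N e) ≡ e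
  edge-index = Inverse.strictlyInverseʳ E¹↔N

  -- Acyclicity makes this order on the finite set of edges irreflexive, hence
  -- noetherian: paths can be counted by recursion on their first edge.
  _⊏_ : Fin N → Fin N → Set
  i ⊏ j = TransClosure Consecutive (edge i) (edge j)

  ⊏-isStrictPartialOrder : IsStrictPartialOrder _≡_ _⊏_
  ⊏-isStrictPartialOrder = record
    { isEquivalence = isEquivalence
    ; irrefl        = λ { refl c → let es , l , eq = closedPath c in acyclic (_ ∷ es) l (sym eq) }
    ; trans         = Plus._++_
    ; <-resp-≈      = resp₂ _⊏_
    }

  private
    finiteFrom : ∀ v → (∀ e → source e ≡ v → ∃[ n ] HasCardinality (From (target e)) n) →
                 ∃[ n ] HasCardinality (From v) n
    finiteFrom v fin = _ , ⊎-cardinality (↔-sym 1↔⊤) (Σ-cardinality E¹↔N (proj₁ ∘ steps) (proj₂ ∘ steps))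
                             ↔-∘ From-unfold v
      where
      steps : ∀ e → ∃[ n ] HasCardinality (source e ≡ v × From (target e)) n
      steps e with source e ≟ v
      ... | no  e≁v = 0 , empty-cardinality (e≁v ∘ proj₁)
      ... | yes e∼v = _ , guard-cardinality (yes e∼v) uip (proj₂ (fin e e∼v))

    finiteAfter : ∀ i → Acc (flip _⊏_) i → ∃[ n ] HasCardinality (From (target (edge i))) n
    finiteAfter i (acc rec) = finiteFrom _ λ f i∼f →
      subst (λ f → ∃[ n ] HasCardinality (From (target f)) n) (edge-index f)
        (finiteAfter (Inverse.to E¹↔N f)
          (rec [ trans (sym i∼f) (cong source (sym (edge-index f))) ]))

    From-finite : ∀ v → ∃[ n ] HasCardinality (From v) n
    From-finite v = finiteFrom v λ e _ →
      subst (λ e → ∃[ n ] HasCardinality (From (target e)) n) (edge-index e)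
        (finiteAfter (Inverse.to E¹↔N e) (spo-noetherian ⊏-isStrictPartialOrder _))

  paths : E⁰ → ℕ
  paths v = proj₁ (From-finite v)

  paths-step : ∀ v → paths v ≡ 1 + out v (paths ∘ target)
  paths-step v = ↔⇒≡ (unfolded ↔-∘ ↔-sym (proj₂ (From-finite v)))
    where
    unfolded : HasCardinality (From v) (1 + out v (paths ∘ target))
    unfolded =
      ⊎-cardinality (↔-sym 1↔⊤)
        (Σ-cardinality E¹↔N _ λ e →
          guard-cardinality (source e ≟ v) uip (proj₂ (From-finite (target e))))
      ↔-∘ From-unfold v

  FP-cardinality : ∀ {n} (E⁰↔n : HasCardinality E⁰ n) →
                   HasCardinality FP (∑ (enumeration E⁰↔n) paths)
  FP-cardinality E⁰↔n = Σ-cardinality E⁰↔n paths (proj₂ ∘ From-finite) ↔-∘ FP↔From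

-- Sums over lists

∑-mono : ∀ {A : Set} (xs : List A) {f g : A → ℕ} → (∀ x → f x ≤ g x) → ∑ xs f ≤ ∑ xs g
∑-mono []       f≤g = z≤n
∑-mono (x ∷ xs) f≤g = +-mono-≤ (f≤g x) (∑-mono xs f≤g)

∑-+ : ∀ {A : Set} (xs : List A) (f g : A → ℕ) → ∑ xs (λ x → f x + g x) ≡ ∑ xs f + ∑ xs g
∑-+ []       f g = refl
∑-+ (x ∷ xs) f g = trans (cong (λ s → f x + g x + s) (∑-+ xs f g)) (eq (f x) (g x) (∑ xs f) (∑ xs g))
  where
  eq : ∀ a b c d → a + b + (c + d) ≡ a + c + (b + d)
  eq = solve-∀

∑-zero : ∀ {A : Set} (xs : List A) → ∑ xs (const 0) ≡ 0
∑-zero []       = refl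
∑-zero (x ∷ xs) = ∑-zero xs

∑-one : ∀ {A : Set} (xs : List A) → ∑ xs (const 1) ≡ length xs
∑-one []       = refl
∑-one (x ∷ xs) = cong suc (∑-one xs)

∑-cong : ∀ {A : Set} (xs : List A) {f g : A → ℕ} → (∀ x → f x ≡ g x) → ∑ xs f ≡ ∑ xs g
∑-cong xs f≡g = cong sum (List.map-cong f≡g xs)

∑-swap : ∀ {A B : Set} (xs : List A) (ys : List B) (h : A → B → ℕ) →
         ∑ xs (λ x → ∑ ys (h x)) ≡ ∑ ys (λ y → ∑ xs (λ x → h x y))
∑-swap []       ys h = sym (∑-zero ys)
∑-swap (x ∷ xs) ys h =
  trans (cong (λ s → ∑ ys (h x) + s) (∑-swap xs ys h)) (sym (∑-+ ys (h x) (λ y → ∑ xs (λ x → h x y))))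

∈⇒≤∑ : ∀ {A : Set} {xs : List A} (f : A → ℕ) {x} → x ∈ xs → f x ≤ ∑ xs f
∈⇒≤∑ f (here refl) = m≤m+n _ _
∈⇒≤∑ f (there x∈)  = ≤-trans (∈⇒≤∑ f x∈) (m≤n+m _ _)

module _ {A : Set} (_≟_ : DecidableEquality A) where

  ∑-absent : ∀ {xs x} c → All (x ≢_) xs → ∑ xs (λ y → if does (x ≟ y) then c else 0) ≡ 0
  ∑-absent c []                       = refl
  ∑-absent {y ∷ _} {x} c (x≢y ∷ x≢ys) rewrite dec-false (x ≟ y) x≢y = ∑-absent c x≢ys

  ∑-indicator : ∀ {xs x} c → Unique xs → x ∈ xs → ∑ xs (λ y → if does (x ≟ y) then c else 0) ≡ c
  ∑-indicator {y ∷ _} c (y≢ ∷ u) (here refl) rewrite dec-true (y ≟ y) refl =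
    trans (cong (λ s → c + s) (∑-absent c y≢)) (+-identityʳ c)
  ∑-indicator {y ∷ _} {x} c (y≢ ∷ u) (there x∈)
    rewrite dec-false (x ≟ y) (λ x≡y → All.lookup y≢ x∈ (sym x≡y)) = ∑-indicator c u x∈

-- At most `total N 1` paths

module OutSumProperties (G : DirectedGraph) {N : ℕ}
  (E¹↔N : HasCardinality (DirectedGraph.E¹ G) N)
  (_≟_ : DecidableEquality (DirectedGraph.E⁰ G)) where
  open DirectedGraph G
  open OutSums G E¹↔N _≟_

  out-term : ∀ {v} (g : E¹ → ℕ) {e} → source e ≡ v → (if does (source e ≟ v) then g e else 0) ≡ g e
  out-term {v} g {e} e∼v rewrite dec-true (source e ≟ v) e∼v = refl

  out-∋ : ∀ {v e} (g : E¹ → ℕ) → source e ≡ v → g e ≤ out v g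
  out-∋ {v} {e} g e∼v = subst (_≤ out v g) (out-term g e∼v) (∈⇒≤∑ _ (∈edgeList e))

  out-mono : ∀ {v} {g h : E¹ → ℕ} → (∀ e → source e ≡ v → g e ≤ h e) → out v g ≤ out v h
  out-mono {v} {g} {h} g≤h = ∑-mono edgeList pointwise
    where
    pointwise : ∀ e → (if does (source e ≟ v) then g e else 0) ≤ (if does (source e ≟ v) then h e else 0)
    pointwise e with source e ≟ v
    ... | yes e∼v = g≤h e e∼v
    ... | no  _   = z≤n

  out-+ : ∀ v (g h : E¹ → ℕ) → out v (λ e → g e + h e) ≡ out v g + out v h
  out-+ v g h = trans (∑-cong edgeList pointwise) (∑-+ edgeList _ _)
    where
    pointwise : ∀ e → (if does (source e ≟ v) then g e + h e else 0) ≡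
                      (if does (source e ≟ v) then g e else 0) + (if does (source e ≟ v) then h e else 0)
    pointwise e with does (source e ≟ v)
    ... | true  = refl
    ... | false = refl

  deg : E⁰ → ℕ
  deg v = out v (const 1)

  out-const : ∀ v c → out v (const c) ≡ deg v * c
  out-const v zero    = trans (trans (∑-cong edgeList pointwise) (∑-zero edgeList)) (sym (*-zeroʳ (deg v)))
    where
    pointwise : ∀ e → (if does (source e ≟ v) then 0 else 0) ≡ 0
    pointwise e with does (source e ≟ v)
    ... | true  = refl
    ... | false = refl
  out-const v (suc c) = begin
    out v (const (suc c))       ≡⟨ out-+ v (const 1) (const c) ⟩
    deg v + out v (const c)     ≡⟨ cong (λ d → deg v + d) (out-const v c) ⟩
    deg v + deg v * c           ≡⟨ *-suc (deg v) c ⟨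
    deg v * suc c               ∎
    where open ≡-Reasoning

  out-bound : ∀ {v M} (g : E¹ → ℕ) → (∀ e → source e ≡ v → g e ≤ M) → out v g ≤ deg v * M
  out-bound {v} {M} g g≤M = ≤-trans (out-mono g≤M) (≤-reflexive (out-const v M))

  out-sink : ∀ {v} (g : E¹ → ℕ) → deg v ≡ 0 → out v g ≡ 0
  out-sink {v} g deg≡0 = n≤0⇒n≡0 (≤-trans (out-bound {M = 0} g absurd) (≤-reflexive (*-zeroʳ (deg v))))
    where
    absurd : ∀ e → source e ≡ v → g e ≤ 0
    absurd e e∼v = contradiction (≤-trans (out-∋ (const 1) e∼v) (≤-reflexive deg≡0)) λ ()

module Bound (G : DirectedGraph) {N n : ℕ}
  (E¹↔N : HasCardinality (DirectedGraph.E¹ G) N)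
  (E⁰↔n : HasCardinality (DirectedGraph.E⁰ G) n)
  (_≟_ : DecidableEquality (DirectedGraph.E⁰ G))
  (incident : ∀ v → (∃[ e ] DirectedGraph.source G e ≡ v) ⊎ (∃[ e ] DirectedGraph.target G e ≡ v))
  (paths : DirectedGraph.E⁰ G → ℕ)
  (paths-step : ∀ v → paths v ≡ 1 + OutSums.out G E¹↔N _≟_ v (paths ∘ DirectedGraph.target G))
  where
  open DirectedGraph G
  open OutSums G E¹↔N _≟_
  open OutSumProperties G E¹↔N _≟_

  sink : E⁰ → ℕ
  sink v = 1 ∸ deg v

  sink-paths : ∀ {v} → deg v ≡ 0 → paths v ≡ 1
  sink-paths {v} deg≡0 = trans (paths-step v) (cong suc (out-sink (paths ∘ target) deg≡0))

  paths-decrease : ∀ e → paths (target e) < paths (source e)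
  paths-decrease e = ≤-trans (s≤s (out-∋ (paths ∘ target) refl)) (≤-reflexive (sym (paths-step (source e))))

  paths-bound : ∀ {v M} → (∀ e → source e ≡ v → paths (target e) ≤ M) → paths v ≤ 1 + deg v * M
  paths-bound {v} below = ≤-trans (≤-reflexive (paths-step v)) (s≤s (out-bound (paths ∘ target) below))

  paths+sink : ∀ {v M} → 2 ≤ M → paths v ≤ M → paths v + sink v ≤ M
  paths+sink {v} 2≤M p≤M with deg v in deg≡
  ... | zero  rewrite sink-paths deg≡ = 2≤M
  ... | suc d rewrite 0∸n≡0 d | +-identityʳ (paths v) = p≤M

  -- A sink gives up its trivial path, and every edge into a sink brings one extra
  -- unit to its source.  Since each sink has an incoming edge, the total does not
  -- decrease (`paths≤charges`), while sinks no longer contribute.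
  charge : E⁰ → ℕ
  charge v = paths v ∸ sink v + out v (sink ∘ target)

  charge-sink : ∀ {v} → deg v ≡ 0 → charge v ≡ 0
  charge-sink {v} deg≡0
    rewrite out-sink (sink ∘ target) deg≡0 | sink-paths deg≡0 | deg≡0 = refl

  -- An edge into a sink carries 1 + 1 ≤ M, so the extra units are absorbed.
  charge-bound : ∀ {v M} → 2 ≤ M → (∀ e → source e ≡ v → paths (target e) ≤ M) → charge v ≤ 1 + deg v * M
  charge-bound {v} {M} 2≤M below = begin
    paths v ∸ sink v + out v (sink ∘ target)
      ≤⟨ +-monoˡ-≤ _ (m∸n≤m (paths v) (sink v)) ⟩
    paths v + out v (sink ∘ target)
      ≡⟨ cong (_+ out v (sink ∘ target)) (paths-step v) ⟩
    1 + (out v (paths ∘ target) + out v (sink ∘ target))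
      ≡⟨ cong suc (out-+ v (paths ∘ target) (sink ∘ target)) ⟨
    1 + out v (λ e → paths (target e) + sink (target e))
      ≤⟨ s≤s (out-bound _ (λ e e∼v → paths+sink 2≤M (below e e∼v))) ⟩
    1 + deg v * M ∎
    where open ≤-Reasoning

  Increasing : List E⁰ → Set
  Increasing = AllPairs (λ u v → paths u ≤ paths v)

  -- The list holds the vertices still to be played; M bounds the path numbers of
  -- those already played.
  Closed : ℕ → List E⁰ → Set
  Closed M ws = ∀ e → source e ∈ ws → paths (target e) ≤ M ⊎ target e ∈ ws

  -- Path numbers drop along edges, so an edge from the vertex with the fewest
  -- paths cannot end in the list.
  Closed-head : ∀ {M w ws} → Increasing (w ∷ ws) → Closed M (w ∷ ws) →
                ∀ e → source e ≡ w → paths (target e) ≤ M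
  Closed-head (w≤ ∷ _) closed e refl with closed e (here refl)
  ... | inj₁ below        = below
  ... | inj₂ (here eq)    = contradiction (paths-decrease e) (<-irrefl (cong paths eq))
  ... | inj₂ (there t∈ws) = contradiction (paths-decrease e) (≤⇒≯ (All.lookup w≤ t∈ws))

  Closed-tail : ∀ {M M′ w ws} → M ≤ M′ → paths w ≤ M′ → Closed M (w ∷ ws) → Closed M′ ws
  Closed-tail M≤M′ w≤M′ closed e s∈ws with closed e (there s∈ws)
  ... | inj₁ below        = inj₁ (≤-trans below M≤M′)
  ... | inj₂ (here refl)  = inj₁ w≤M′
  ... | inj₂ (there t∈ws) = inj₂ t∈ws

  -- Each vertex that is not a sink is one move of the game, its out-degree being
  -- the number of units spent.
  charges≤gain : ∀ {M} ws → 2 ≤ M → Increasing ws → Closed M ws →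
                 ∑ ws charge ≤ gain (∑ ws deg) M
  charges≤gain []       2≤M inc closed = z≤n
  charges≤gain {M} (w ∷ ws) 2≤M inc@(_ ∷ inc′) closed = byDegree (deg w) refl
    where
    below : ∀ e → source e ≡ w → paths (target e) ≤ M
    below = Closed-head inc closed

    byDegree : ∀ d → deg w ≡ d → charge w + ∑ ws charge ≤ gain (d + ∑ ws deg) M
    byDegree zero deg≡0 = +-mono-≤ (≤-reflexive (charge-sink deg≡0))
      (charges≤gain ws 2≤M inc′
        (Closed-tail ≤-refl (≤-trans (≤-reflexive (sink-paths deg≡0)) (≤-trans (n≤1+n 1) 2≤M)) closed))
    byDegree (suc a) deg≡ = ≤-trans
      (+-mono-≤ (subst (λ d → charge w ≤ 1 + d * M) deg≡ (charge-bound 2≤M below))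
                (charges≤gain ws (≤-trans 2≤M M≤M′) inc′
                  (Closed-tail M≤M′ (subst (λ d → paths w ≤ 1 + d * M) deg≡ (paths-bound below)) closed)))
      (gain-step a (∑ ws deg) M)
      where
      M≤M′ : M ≤ 1 + suc a * M
      M≤M′ = ≤-trans (m≤m+n M (a * M)) (n≤1+n _)

  -- At the first vertex with outgoing edges every target is a sink, and an edge
  -- carries 2 although M = 1.  For a single edge the surplus is the score of the
  -- starting number; otherwise the moves 1 and suc b score at least as much as
  -- the charge and reach at least as high as the single move suc (suc b).
  first-charge : ∀ a r → 1 + suc a * 2 + gain r (1 + suc a * 1) ≤ 1 + gain (suc a + r) 1
  first-charge zero    r = s≤s (gain-step 0 r 1)
  first-charge (suc b) r = begin
    1 + (2 + b) * 2 + gain r (1 + (2 + b) * 1)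
      ≤⟨ +-mono-≤ (n≤1+n _) (gain-mono r (s≤s narrow)) ⟩
    2 + (2 + b) * 2 + gain r (1 + suc b * 2)
      ≡⟨ eq b (gain r (1 + suc b * 2)) ⟩
    1 + (2 + total r (1 + suc b * 2))
      ≤⟨ s≤s (+-monoʳ-≤ 2 (gain-step b r 2)) ⟩
    1 + total (suc b + r) 2
      ≤⟨ s≤s (gain-step 0 (suc b + r) 1) ⟩
    1 + gain (2 + b + r) 1 ∎
    where
    open ≤-Reasoning
    eq : ∀ b x → 2 + (2 + b) * 2 + x ≡ 1 + (2 + (1 + suc b * 2 + x))
    eq = solve-∀
    narrow : (2 + b) * 1 ≤ suc b * 2
    narrow = ≤-trans (m≤m+n _ b) (≤-reflexive (lem b))
      where
      lem : ∀ b → (2 + b) * 1 + b ≡ suc b * 2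
      lem = solve-∀

  charges≤total : ∀ ws → Increasing ws → Closed 1 ws → ∑ ws charge ≤ total (∑ ws deg) 1
  charges≤total []       inc closed = z≤n
  charges≤total (w ∷ ws) inc@(_ ∷ inc′) closed = byDegree (deg w) refl
    where
    below : ∀ e → source e ≡ w → paths (target e) ≤ 1
    below = Closed-head inc closed

    byDegree : ∀ d → deg w ≡ d → charge w + ∑ ws charge ≤ total (d + ∑ ws deg) 1
    byDegree zero deg≡0 = +-mono-≤ (≤-reflexive (charge-sink deg≡0))
      (charges≤total ws inc′ (Closed-tail ≤-refl (≤-reflexive (sink-paths deg≡0)) closed))
    byDegree (suc a) deg≡ = ≤-trans
      (+-mono-≤ (subst (λ d → charge w ≤ 1 + d * 2) deg≡
                  (charge-bound ≤-refl (λ e e∼w → ≤-trans (below e e∼w) (n≤1+n 1))))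
                (charges≤gain ws (s≤s (s≤s z≤n)) inc′
                  (Closed-tail (s≤s z≤n) (subst (λ d → paths w ≤ 1 + d * 1) deg≡ (paths-bound below)) closed)))
      (first-charge a (∑ ws deg))

  vertices : List E⁰
  vertices = enumeration E⁰↔n

  ∈vertices : ∀ v → v ∈ vertices
  ∈vertices v = subst (_∈ vertices) (Inverse.strictlyInverseʳ E⁰↔n v) (∈-tabulate⁺ (Inverse.to E⁰↔n v))

  vertices-unique : Unique vertices
  vertices-unique = Unique.tabulate⁺ (Injection.injective (↔⇒↣ (↔-sym E⁰↔n)))

  fibres : ∀ (end : E¹ → E⁰) (g : E¹ → ℕ) →
    ∑ vertices (λ v → ∑ edgeList λ e → if does (end e ≟ v) then g e else 0) ≡ ∑ edgeList g
  fibres end g = trans (∑-swap vertices edgeList _)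
    (∑-cong edgeList λ e → ∑-indicator _≟_ (g e) vertices-unique (∈vertices (end e)))

  degree-sum : ∑ vertices deg ≡ N
  degree-sum = trans (fibres source (const 1))
                     (trans (∑-one edgeList) (List.length-tabulate (Inverse.from E¹↔N)))

  sinks≤ : ∑ vertices sink ≤ ∑ edgeList (sink ∘ target)
  sinks≤ = ≤-trans (∑-mono vertices reached) (≤-reflexive (fibres target (sink ∘ target)))
    where
    reached : ∀ v → sink v ≤ ∑ edgeList λ e → if does (target e ≟ v) then sink (target e) else 0
    reached v with incident v
    ... | inj₁ (e , e∼v) = ≤-trans (≤-reflexive (m≤n⇒m∸n≡0 (out-∋ (const 1) e∼v))) z≤n
    ... | inj₂ (e , refl) = ≤-trans (≤-reflexive (sym (eq (dec-true (target e ≟ target e) refl)))) (∈⇒≤∑ _ (∈edgeList e))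
      where
      eq : ∀ {b c} → b ≡ true → (if b then c else 0) ≡ c
      eq refl = refl

  paths≤charges : ∑ vertices paths ≤ ∑ vertices charge
  paths≤charges = begin
    ∑ vertices paths
      ≤⟨ ∑-mono vertices (λ v → m≤n+m∸n (paths v) (sink v)) ⟩
    ∑ vertices (λ v → sink v + (paths v ∸ sink v))
      ≡⟨ ∑-+ vertices sink (λ v → paths v ∸ sink v) ⟩
    ∑ vertices sink + ∑ vertices (λ v → paths v ∸ sink v)
      ≤⟨ +-monoˡ-≤ _ sinks≤ ⟩
    ∑ edgeList (sink ∘ target) + ∑ vertices (λ v → paths v ∸ sink v)
      ≡⟨ cong (_+ ∑ vertices (λ v → paths v ∸ sink v)) (fibres source (sink ∘ target)) ⟨
    ∑ vertices (λ v → out v (sink ∘ target)) + ∑ vertices (λ v → paths v ∸ sink v)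
      ≡⟨ +-comm (∑ vertices (λ v → out v (sink ∘ target))) _ ⟩
    ∑ vertices (λ v → paths v ∸ sink v) + ∑ vertices (λ v → out v (sink ∘ target))
      ≡⟨ ∑-+ vertices (λ v → paths v ∸ sink v) (λ v → out v (sink ∘ target)) ⟨
    ∑ vertices charge ∎
    where open ≤-Reasoning

  paths≤total : ∑ vertices paths ≤ total N 1
  paths≤total = begin
    ∑ vertices paths      ≤⟨ paths≤charges ⟩
    ∑ vertices charge     ≡⟨ sum-↭ (Perm.map⁺ charge (sort-↭ byPaths vertices)) ⟨
    ∑ ws charge           ≤⟨ charges≤total ws increasing closed ⟩
    total (∑ ws deg) 1    ≡⟨ cong (λ m → total m 1) (sum-↭ (Perm.map⁺ deg (sort-↭ byPaths vertices))) ⟩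
    total (∑ vertices deg) 1 ≡⟨ cong (λ m → total m 1) degree-sum ⟩
    total N 1             ∎
    where
    open ≤-Reasoning
    byPaths = On.decTotalOrder ≤-decTotalOrder paths
    ws = sort byPaths vertices
    increasing : Increasing ws
    increasing = Linked⇒AllPairs ≤-trans (sort-↗ byPaths vertices)
    closed : Closed 1 ws
    closed e _ = inj₂ (Perm.∈-resp-↭ (↭-sym (sort-↭ byPaths vertices)) (∈vertices (target e)))

-- The edge e₀ excludes the graph with a single vertex and guarantees that every
-- vertex lies on an edge, whence the vertices are the finitely many endpoints.
finite-paths : ∀ G {N} → IsConnectedAcyclicWithEdges N G → DirectedGraph.E¹ G →
               ∃[ m ] (HasCardinality (DirectedGraph.FP G) m × m ≤ total N 1)
finite-paths G {N} admissible e₀ =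
  _ , FP-cardinality E⁰↔n , Bound.paths≤total G E¹↔N E⁰↔n _≟_ (incident e₀) paths paths-step
  where
  open DirectedGraph G
  open IsConnectedAcyclicWithEdges admissible renaming (edges to E¹↔N)
  open Discreteness G (via-injection (↔⇒↣ E¹↔N) Fin._≟_) connected
  open OutSums G E¹↔N _≟_ using (edgeList; ∈edgeList)
  open Counting G E¹↔N _≟_ acyclic

  endpoints : List E⁰
  endpoints = deduplicate _≟_ (map source edgeList ++ map target edgeList)

  ∈endpoints : ∀ v → v ∈ endpoints
  ∈endpoints v = ∈-deduplicate⁺ _≟_ (v∈ (incident e₀ v))
    where
    v∈ : (∃[ e ] source e ≡ v) ⊎ (∃[ e ] target e ≡ v) → v ∈ map source edgeList ++ map target edgeList
    v∈ (inj₁ (f , refl)) = ∈-++⁺ˡ (∈-map⁺ source (∈edgeList f))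
    v∈ (inj₂ (f , refl)) = ∈-++⁺ʳ _ (∈-map⁺ target (∈edgeList f))

  E⁰↔n : HasCardinality E⁰ (length endpoints)
  E⁰↔n = unique⇒cardinality (deduplicate-! _≟_ _) ∈endpoints

-- Chains attain the bound

open DirectedGraph using (E⁰; E¹; source; target; FP; Acyclic; Connected; _⟶_)
open Paths using (From; stop; step)

-- A height function that drops along every edge, which rules out closed paths.
Ranked : DirectedGraph → Set
Ranked G = Σ (E⁰ G → ℕ) λ rank → ∀ e → rank (target G e) < rank (source G e)

ranked⇒acyclic : ∀ {G} → Ranked G → Acyclic G
ranked⇒acyclic {G} (rank , drop) (e ∷ es) l closed = <-irrefl (cong rank (sym closed)) (descent e es l)
  where
  open DirectedGraph G using (Consecutive)
  open Paths G using (last-∷)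
  descent : ∀ e es → Linked Consecutive (e ∷ es) → rank (target G (last (e ∷ es))) < rank (source G e)
  descent e []       [-]     = drop e
  descent e (f ∷ es) (r ∷ l)
    = subst (λ g → rank (target G g) < rank (source G e)) (sym (last-∷ e f es))
        (<-trans (descent f es l) (subst (λ v → rank v < rank (source G e)) r (drop e)))

point : DirectedGraph
point = record { E⁰ = ⊤ ; E¹ = ⊥ ; source = λ () ; target = λ () }

-- A new vertex joined to `top` by a parallel edges.  It receives no edges, so the
-- paths from old vertices are unchanged and 1 + a * β paths start at it, where β
-- paths start at `top`: on profiles this is `grow a`.
module AddSource (G : DirectedGraph) (top : E⁰ G) (a : ℕ) where

  extended : DirectedGraph
  extended = record
    { E⁰     = Maybe (E⁰ G)
    ; E¹     = Fin a ⊎ E¹ G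
    ; source = λ { (inj₁ _) → nothing  ; (inj₂ e) → just (source G e) }
    ; target = λ { (inj₁ _) → just top ; (inj₂ e) → just (target G e) }
    }

  edge-cardinality : ∀ {N} → HasCardinality (E¹ G) N → HasCardinality (E¹ extended) (a + N)
  edge-cardinality = ⊎-cardinality (↔-id _)

  ranked : Ranked G → Ranked extended
  ranked (rank , drop) = rank′ , λ { (inj₁ _) → ≤-refl ; (inj₂ e) → drop e }
    where
    rank′ : Maybe (E⁰ G) → ℕ
    rank′ nothing  = suc (rank top)
    rank′ (just v) = rank v

  connected : Fin a → Connected G → Connected extended
  connected i conn u v = toNew u ◅◅ Eq.symmetric _ (toNew v)
    where
    toNew : ∀ v → EqClosure (_⟶_ extended) v nothing
    toNew nothing  = ε
    toNew (just v) =
      Eq.gmap just (λ { (e , refl , refl) → inj₂ e , refl , refl }) (conn v top)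
        ◅◅ bwd (inj₁ i , refl , refl) ◅ ε

  private
    raise : ∀ {v} → From G v → From extended (just v)
    raise stop       = stop
    raise (step e p) = step (inj₂ e) (raise p)

    lower : ∀ {u v} → From extended u → u ≡ just v → From G v
    lower stop              eq   = stop
    lower (step (inj₁ i) p) ()
    lower (step (inj₂ e) p) refl = step e (lower p refl)

    lower-raise : ∀ {v} (p : From G v) → lower (raise p) refl ≡ p
    lower-raise stop       = refl
    lower-raise (step e p) = cong (step e) (lower-raise p)

    raise-lower : ∀ {u v} (p : From extended u) (eq : u ≡ just v) →
                  raise (lower p eq) ≡ subst (From extended) eq p
    raise-lower stop              refl = refl
    raise-lower (step (inj₁ i) p) ()
    raise-lower (step (inj₂ e) p) refl = cong (step (inj₂ e)) (raise-lower p refl)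

  From-just : ∀ v → From extended (just v) ↔ From G v
  From-just v = mk↔ₛ′ (λ p → lower p refl) raise lower-raise (λ p → raise-lower p refl)

  From-new : ∀ {β} → HasCardinality (From G top) β → HasCardinality (From extended nothing) (1 + a * β)
  From-new From↔β =
    ⊎-cardinality (↔-sym 1↔⊤)
      (↔-sym *↔× ↔-∘ ((↔-id _ ×-↔ (From↔β ↔-∘ From-just top)) ↔-∘ firstEdges))
    ↔-∘ Paths.From-unfold extended nothing
    where
    firstEdges : Σ (E¹ extended) (λ e → source extended e ≡ nothing × From extended (target extended e)) ↔
                 (Fin a × From extended (just top))
    firstEdges = mk↔ₛ′ (λ { (inj₁ i , refl , p) → i , p })
                       (λ { (i , p) → inj₁ i , refl , p })
                       (λ { (i , p) → refl })
                       (λ { (inj₁ i , refl , p) → refl })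

  From-all : Σ (E⁰ extended) (From extended) ↔ (From extended nothing ⊎ Σ (E⁰ G) (From G))
  From-all = (↔-id _ ⊎-↔ Σ-cong.cong (↔-id _) (λ {v} → From-just v)) ↔-∘ split
    where
    split : Σ (E⁰ extended) (From extended) ↔ (From extended nothing ⊎ Σ (E⁰ G) (λ v → From extended (just v)))
    split = mk↔ₛ′ (λ { (nothing , p) → inj₁ p ; (just v , p) → inj₂ (v , p) })
                  (λ { (inj₁ p) → nothing , p ; (inj₂ (v , p)) → just v , p })
                  (λ { (inj₁ p) → refl ; (inj₂ (v , p)) → refl })
                  (λ { (nothing , p) → refl ; (just v , p) → refl })

mutual
  chain : List ℕ → DirectedGraph
  chain []      = point
  chain (a ∷ w) = AddSource.extended (chain w) (top w) a

  top : ∀ w → E⁰ (chain w)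
  top []      = tt
  top (a ∷ w) = nothing

chain-edges : ∀ w → HasCardinality (E¹ (chain w)) (sum w)
chain-edges []      = ↔-sym 0↔⊥
chain-edges (a ∷ w) = AddSource.edge-cardinality (chain w) (top w) a (chain-edges w)

chain-ranked : ∀ w → Ranked (chain w)
chain-ranked []      = (λ _ → 0) , λ ()
chain-ranked (a ∷ w) = AddSource.ranked (chain w) (top w) a (chain-ranked w)

-- An inhabitant of Fin a witnesses that the multiplicity a is positive.
chain-connected : ∀ {w} → All Fin w → Connected (chain w)
chain-connected []                _ _ = ε
chain-connected {a ∷ w} (i ∷ is) = AddSource.connected (chain w) (top w) a i (chain-connected is)

chain-From-top : ∀ w → HasCardinality (From (chain w) (top w)) (proj₁ (profile w))
chain-From-top []      = mk↔ₛ′ (λ _ → zero) (λ _ → stop) (λ { zero → refl }) λ { stop → refl }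
chain-From-top (a ∷ w) = AddSource.From-new (chain w) (top w) a (chain-From-top w)

chain-From : ∀ w → HasCardinality (Σ (E⁰ (chain w)) (From (chain w))) (pathCount w)
chain-From []      = chain-From-top [] ↔-∘ mk↔ₛ′ proj₂ (tt ,_) (λ _ → refl) (λ _ → refl)
chain-From (a ∷ w) =
  ⊎-cardinality (chain-From-top (a ∷ w)) (chain-From w) ↔-∘ AddSource.From-all (chain w) (top w) a

chain-paths : ∀ w → HasCardinality (FP (chain w)) (pathCount w)
chain-paths w = chain-From w ↔-∘ Paths.FP↔From (chain w)

chain-admissible : ∀ {w} → All Fin w → IsConnectedAcyclicWithEdges (sum w) (chain w)
chain-admissible {w} is = record
  { edges     = chain-edges w
  ; connected = chain-connected is
  ; acyclic   = ranked⇒acyclic (chain-ranked w)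
  }

bestWord-positive : ∀ e → All Fin (bestWord e)
bestWord-positive 0 = []
bestWord-positive 1 = zero ∷ []
bestWord-positive 2 = zero ∷ zero ∷ []
bestWord-positive 3 = zero ∷ zero ∷ []
bestWord-positive 4 = zero ∷ zero ∷ zero ∷ []
bestWord-positive 5 = zero ∷ zero ∷ zero ∷ []
bestWord-positive 6 = zero ∷ zero ∷ zero ∷ []
bestWord-positive 7 = zero ∷ zero ∷ zero ∷ zero ∷ []
bestWord-positive (suc (suc (suc (suc (suc (suc (suc (suc e)))))))) =
  zero ∷ bestWord-positive (suc (suc (suc (suc (suc e)))))

-- The maximum

chain-maximal : ∀ w {N P} → 1 ≤ N → All Fin w → sum w ≡ N → pathCount w ≡ P → total N 1 ≤ P →
                IsMaximalNumberOfPaths N P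
chain-maximal w {N} {P} (s≤s _) positive sum≡N count≡P bound = record
  { attained   = chain w , subst (λ N → IsConnectedAcyclicWithEdges N (chain w)) sum≡N (chain-admissible positive)
               , subst (HasCardinality (DirectedGraph.FP (chain w))) count≡P (chain-paths w)
  ; upperBound = λ E admissible →
      let e₀ = Inverse.from (IsConnectedAcyclicWithEdges.edges admissible) zero
          m , FP↔m , m≤total = finite-paths E admissible e₀
      in  m , FP↔m , ≤-trans m≤total bound
  }

-- Otherwise 3 * k + i would be at most 18 - 3.
quotient-bound : ∀ k i b → 3 * k + i ≥ 16 → i + 3 * b ≤ 18 → b ≤ k
quotient-bound k i b large small = ≮⇒≥ λ k<b → <⇒≱ (s≤s large)
  (+-cancelˡ-≤ 2 _ _ (≤-trans (≤-reflexive (eq k i)) (≤-trans (+-monoʳ-≤ i (*-monoʳ-≤ 3 k<b)) small)))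
  where
  eq : ∀ k i → 2 + (1 + (3 * k + i)) ≡ i + 3 * (1 + k)
  eq = solve-∀

maximal₀ : ∀ n → IsMaximalNumberOfPaths (3 * (6 + n) + 0) (value 8 16 (best (n * 3 + 12)))
maximal₀ n = subst (λ N → IsMaximalNumberOfPaths N (value 8 16 (best (n * 3 + 12)))) (eq n)
  (chain-maximal (1 ∷ 2 ∷ 3 ∷ bestWord (n * 3 + 12)) (≤-trans (s≤s z≤n) (m≤n+m 18 (n * 3)))
    (zero ∷ zero ∷ zero ∷ bestWord-positive (n * 3 + 12))
    (trans (cong (λ s → 6 + s) (sum-bestWord (n * 3 + 12))) (eq′ n))
    (pathCount-123 (bestWord (n * 3 + 12)))
    (total-bound₁₈ n))
  where
  eq : ∀ n → n * 3 + 18 ≡ 3 * (6 + n) + 0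
  eq = solve-∀
  eq′ : ∀ n → 6 + (n * 3 + 12) ≡ n * 3 + 18
  eq′ = solve-∀

maximal₁ : ∀ n → IsMaximalNumberOfPaths (3 * (5 + n) + 1) (value 8 11 (best (n * 3 + 11)))
maximal₁ n = subst (λ N → IsMaximalNumberOfPaths N (value 8 11 (best (n * 3 + 11)))) (eq n)
  (chain-maximal (1 ∷ 2 ∷ 2 ∷ bestWord (n * 3 + 11)) (≤-trans (s≤s z≤n) (m≤n+m 16 (n * 3)))
    (zero ∷ zero ∷ zero ∷ bestWord-positive (n * 3 + 11))
    (trans (cong (λ s → 5 + s) (sum-bestWord (n * 3 + 11))) (eq′ n))
    (pathCount-122 (bestWord (n * 3 + 11)))
    (total-bound₁₆ n))
  where
  eq : ∀ n → n * 3 + 16 ≡ 3 * (5 + n) + 1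
  eq = solve-∀
  eq′ : ∀ n → 5 + (n * 3 + 11) ≡ n * 3 + 16
  eq′ = solve-∀

maximal₂ : ∀ n → IsMaximalNumberOfPaths (3 * (5 + n) + 2) (value 8 11 (best (n * 3 + 12)))
maximal₂ n = subst (λ N → IsMaximalNumberOfPaths N (value 8 11 (best (n * 3 + 12)))) (eq n)
  (chain-maximal (1 ∷ 2 ∷ 2 ∷ bestWord (n * 3 + 12)) (≤-trans (s≤s z≤n) (m≤n+m 17 (n * 3)))
    (zero ∷ zero ∷ zero ∷ bestWord-positive (n * 3 + 12))
    (trans (cong (λ s → 5 + s) (sum-bestWord (n * 3 + 12))) (eq′ n))
    (pathCount-122 (bestWord (n * 3 + 12)))
    (total-bound₁₇ n))
  where
  eq : ∀ n → n * 3 + 17 ≡ 3 * (5 + n) + 2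
  eq = solve-∀
  eq′ : ∀ n → 5 + (n * 3 + 12) ≡ n * 3 + 17
  eq′ = solve-∀

theorem3p15 : ∀ (N k : ℕ) (i : Fin 3) → N ≥ 16 → N ≡ 3 * k + toℕ i →
    ∃[ P ] (IsMaximalNumberOfPaths N P × + P / 1 ≡ closedForm k i)
theorem3p15 N k zero N≥16 refl
  with k ∸ 6 | m+[n∸m]≡n (quotient-bound k 0 6 N≥16 (from-yes (18 ≤? 18)))
... | n | refl = _ , maximal₀ n ,
  quarter (value 8 16 (best (n * 3 + 12))) 121 (3 ^ (4 + n)) (6 + n) 7 (formula₀ n)
theorem3p15 N k (suc zero) N≥16 refl
  with k ∸ 5 | m+[n∸m]≡n (quotient-bound k 1 5 N≥16 (from-yes (16 ≤? 18)))
... | n | refl = _ , maximal₁ n ,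
  quarter (value 8 11 (best (n * 3 + 11))) 529 (3 ^ (2 + n)) (5 + n) 25 (formula₁ n)
theorem3p15 N k (suc (suc zero)) N≥16 refl
  with k ∸ 5 | m+[n∸m]≡n (quotient-bound k 2 5 N≥16 (from-yes (17 ≤? 18)))
... | n | refl = _ , maximal₂ n ,
  quarter (value 8 11 (best (n * 3 + 12))) 253 (3 ^ (3 + n)) (5 + n) 15 (formula₂ n)
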